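{- Let $A\subseteq \mathbb{F}_5^2$ be a sum-free set with $|A|\ge 5$. If $A$ is not normal, then $A$ is isomorphic to one of the following two sets (with coordinates in $\mathbb{F}_5=\{ -2,-1,0,1,2\}$): $$\{(-2,1),(-1,1),(0,1),(1,1),(1,-2)\}\quad\text{or}\quad \{(-1,1),(0,1),(1,1),(1,-2),(-1,-1)\}.$$
   Context: A subset $A$ of an abelian group is sum-free if there are no (not necessarily distinct) $x,y,z\in A$ with $x+y=z$. A sum-free set $A\subseteq\mathbb{F}_5^n$ is called normal if $A\subseteq H\cup(-H)$ for some affine hyperplane $H\subseteq \mathbb{F}_5^n$ not containing the origin (for $n=2$, an affine line not through the origin). Two subsets of $\mathbb{F}_5^2$ are isomorphic if some linear automorphism of $\mathbb{F}_5^2$ maps one onto the other. -}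

module Defs where

open import Algebra.Bundles using (AbelianGroup; CommutativeRing)
open import Algebra.Module.Bundles using (Module)
import Algebra.Module.Construct.DirectProduct as DirectProduct
import Algebra.Module.Construct.TensorUnit as TensorUnit
open import Algebra.Module.Morphism.Structures using (module ModuleMorphisms)
open import Data.Fin.Base using (Fin; toℕ; combine)
open import Data.Fin.Patterns using (0F; 1F; 2F)
open import Data.Fin.Properties using (_≟_; all?)
import Data.Fin.Subset as Subset
open import Data.List.Base using (List; []; _∷_)
import Data.List.Membership.Propositional as List
import Data.Nat.Base as ℕ
open import Data.Nat.DivMod using (_mod_)
open import Data.Product.Base using (∃; _×_; _,_)
open import Level using (Level; 0ℓ; _⊔_)
open import Relation.Binary.PropositionalEquality using (_≡_; cong; cong₂; isEquivalence)
open import Relation.Nullary using (¬_)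
open import Relation.Nullary.Decidable using (toWitness)
open import Relation.Unary using (Pred; _∈_; _∉_; _⊆_; _∪_; _≐_)

private
  variable
    a ℓ p : Level

SumFree : (G : AbelianGroup a ℓ) → Pred (AbelianGroup.Carrier G) p → Set (a ⊔ ℓ ⊔ p)
SumFree G A = ∀ {x y z} → x ∈ A → y ∈ A → z ∈ A → ¬ (x ∙ y ≈ z)
  where open AbelianGroup G

infixl 6 _+₅_
infixl 7 _*₅_
infix  8 -₅_

_+₅_ _*₅_ : Fin 5 → Fin 5 → Fin 5
x +₅ y = (toℕ x ℕ.+ toℕ y) mod 5
x *₅ y = (toℕ x ℕ.* toℕ y) mod 5

-₅_ : Fin 5 → Fin 5
-₅ x = (5 ℕ.∸ toℕ x) mod 5

F₅ : CommutativeRing 0ℓ 0ℓ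
F₅ = record
  { Carrier = Fin 5
  ; _≈_     = _≡_
  ; _+_     = _+₅_
  ; _*_     = _*₅_
  ; -_      = -₅_
  ; 0#      = 0F
  ; 1#      = 1F
  ; isCommutativeRing = record
    { isRing = record
      { +-isAbelianGroup = record
        { isGroup = record
          { isMonoid = record
            { isSemigroup = record
              { isMagma = record
                { isEquivalence = isEquivalence
                ; ∙-cong        = cong₂ _+₅_
                }
              ; assoc = toWitness {a? = all? λ x → all? λ y → all? λ z →
                          (x +₅ y) +₅ z ≟ x +₅ (y +₅ z)} _
              }
            ; identity = toWitness {a? = all? λ x → 0F +₅ x ≟ x} _
                       , toWitness {a? = all? λ x → x +₅ 0F ≟ x} _
            }
          ; inverse = toWitness {a? = all? λ x → -₅ x +₅ x ≟ 0F} _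
                    , toWitness {a? = all? λ x → x +₅ -₅ x ≟ 0F} _
          ; ⁻¹-cong = cong -₅_
          }
        ; comm = toWitness {a? = all? λ x → all? λ y → x +₅ y ≟ y +₅ x} _
        }
      ; *-cong     = cong₂ _*₅_
      ; *-assoc    = toWitness {a? = all? λ x → all? λ y → all? λ z →
                       (x *₅ y) *₅ z ≟ x *₅ (y *₅ z)} _
      ; *-identity = toWitness {a? = all? λ x → 1F *₅ x ≟ x} _
                   , toWitness {a? = all? λ x → x *₅ 1F ≟ x} _
      ; distrib    = toWitness {a? = all? λ x → all? λ y → all? λ z →
                       x *₅ (y +₅ z) ≟ x *₅ y +₅ x *₅ z} _
                   , toWitness {a? = all? λ x → all? λ y → all? λ z →
                       (y +₅ z) *₅ x ≟ y *₅ x +₅ z *₅ x} _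
      }
    ; *-comm = toWitness {a? = all? λ x → all? λ y → x *₅ y ≟ y *₅ x} _
    }
  }

F₅² : Module F₅ 0ℓ 0ℓ
F₅² = DirectProduct.⟨module⟩ TensorUnit.⟨module⟩ TensorUnit.⟨module⟩

open Module F₅² using (Carrierᴹ; _≈ᴹ_; _+ᴹ_; _*ₗ_; -ᴹ_; 0ᴹ; rawModule) public
open Module F₅² using (+ᴹ-abelianGroup)

-- A subset of the plane is a library subset of Fin 25, the point (x , y)
-- being numbered 5x + y; its cardinality is the library's ∣_∣.
PlaneSubset : Set
PlaneSubset = Subset.Subset (5 ℕ.* 5)

⟦_⟧ : PlaneSubset → Pred Carrierᴹ 0ℓ
⟦ A ⟧ (x , y) = combine x y Subset.∈ A

SumFreeInPlane : Pred Carrierᴹ 0ℓ → Set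
SumFreeInPlane = SumFree +ᴹ-abelianGroup

Image : (Carrierᴹ → Carrierᴹ) → Pred Carrierᴹ 0ℓ → Pred Carrierᴹ 0ℓ
Image f A w = ∃ λ v → v ∈ A × f v ≈ᴹ w

record AffineLine : Set where
  field
    base        : Carrierᴹ
    direction   : Carrierᴹ
    direction≉0 : ¬ (direction ≈ᴹ 0ᴹ)

  points : Pred Carrierᴹ 0ℓ
  points v = ∃ λ t → v ≈ᴹ base +ᴹ t *ₗ direction

open AffineLine public using (points)

Normal : Pred Carrierᴹ 0ℓ → Set
Normal A = ∃ λ (H : AffineLine) → 0ᴹ ∉ points H × A ⊆ points H ∪ Image -ᴹ_ (points H)

Isomorphic : Pred Carrierᴹ 0ℓ → Pred Carrierᴹ 0ℓ → Set
Isomorphic A B = ∃ λ φ → IsModuleIsomorphism φ × Image φ A ≐ B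
  where open ModuleMorphisms rawModule rawModule

fromList : List Carrierᴹ → Pred Carrierᴹ 0ℓ
fromList vs v = v List.∈ vs

exceptional₁ exceptional₂ : Pred Carrierᴹ 0ℓ
exceptional₁ = fromList
  ((-₅ 2F , 1F) ∷ (-₅ 1F , 1F) ∷ (0F , 1F) ∷ (1F , 1F) ∷ (1F , -₅ 2F) ∷ [])
exceptional₂ = fromList
  ((-₅ 1F , 1F) ∷ (0F , 1F) ∷ (1F , 1F) ∷ (1F , -₅ 2F) ∷ (-₅ 1F , -₅ 1F) ∷ [])

{-# OPTIONS --safe #-}

-- A non-normal sum-free set with at least five elements contains two independent vectors, which may
-- be taken as the coordinate vectors e₁ and e₂. Sum-freeness then leaves 15 further points that the
-- set can contain, and a binary search over these, adding or rejecting one point at a time, is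
-- decided by evaluation. A branch is cut as soon as all chosen and still available points number
-- fewer than five or satisfy f v = ±1 for one nonzero functional f. Each surviving branch ends in a
-- five-element set that a matrix carries onto one of the two exceptional sets.

module Submission where

open import Defs
open import Algebra.Bundles using (CommutativeMonoid)
open import Algebra.Module.Bundles using (Module)
import Algebra.Module.Morphism.Construct.Composition as Composition
open import Algebra.Module.Morphism.Structures using (module ModuleMorphisms)
import Algebra.Module.Properties as ModuleProperties
import Algebra.Properties.CommutativeSemigroup as CommutativeSemigroup
open import Data.Bool.Base using (true; false)
open import Data.Empty using (⊥)
open import Data.Fin.Base using (Fin; combine; remQuot)
open import Data.Fin.Patterns using (0F; 1F; 2F; 3F; 4F)
open import Data.Fin.Properties using (_≟_; all?; any?; combine-remQuot)
open import Data.Fin.Subset using (Subset; ∣_∣; ⁅_⁆; ⋃)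
  renaming (_∈_ to _∈ₛ_; _⊆_ to _⊆ₛ_; _∪_ to _∪ₛ_)
open import Data.Fin.Subset.Properties using (∣⊥∣≡0; ∣⁅x⁆∣≡1; x∈⁅x⁆; x∈p∪q⁺; p⊆q⇒∣p∣≤∣q∣)
  renaming (_∈?_ to _∈ₛ?_)
open import Data.List.Base
  using (List; []; _∷_; _++_; length; map; filter; cartesianProduct; allFin)
open import Data.List.Membership.Propositional using () renaming (_∈_ to _∈ₗ_; _∉_ to _∉ₗ_)
open import Data.List.Membership.Propositional.Properties
  using (∈-map⁺; ∈-++⁺ˡ; ∈-++⁺ʳ; ∈-++⁻; ∈-filter⁺; ∈-cartesianProduct⁺; ∈-allFin)
open import Data.List.Properties using (length-map; ++-identityʳ)
open import Data.List.Relation.Binary.Permutation.Propositional.Properties using (∈-resp-↭; shift)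
open import Data.List.Relation.Unary.All as All using (All; []; _∷_)
open import Data.List.Relation.Unary.Any as Any using (here; there)
open import Data.Nat.Base as ℕ using (ℕ; zero; suc; _≥_; _<_; _≤_; z≤n; s≤s)
open import Data.Nat.Properties
  using (≤-trans; ≤-reflexive; +-suc; +-monoʳ-≤; n≤1+n; n<1+n; <⇒≱; _<?_; module ≤-Reasoning)
open import Data.Product.Base using (∃; _×_; _,_; proj₁; proj₂)
open import Data.Product.Properties using (≡-dec)
open import Data.Product.Relation.Binary.Pointwise.NonDependent using (≡×≡⇒≡; ≡⇒≡×≡)
open import Data.Sum.Base as Sum using (_⊎_; inj₁; inj₂)
open import Data.Vec.Base using ([]; _∷_)
open import Function.Base using (_∘_; id; case_of_)
open import Level using (0ℓ)
open import Relation.Binary.Definitions using (DecidableEquality)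
open import Relation.Binary.PropositionalEquality
  using (_≡_; _≢_; refl; sym; trans; cong; cong₂; subst; module ≡-Reasoning)
open import Relation.Nullary using (¬_; Dec; yes; no; contradiction)
open import Relation.Nullary.Decidable
  using (toWitness; map′; decidable-stable; ¬?; _×-dec_; _⊎-dec_; _→-dec_)
open import Relation.Unary using (Pred; _∈_; _∉_; _⊆_; _∪_; Decidable)

open Module F₅² hiding (Carrierᴹ; _≈ᴹ_; _+ᴹ_; _*ₗ_; -ᴹ_; 0ᴹ; rawModule)
open ModuleMorphisms rawModule rawModule
open ModuleProperties F₅² using (-ᴹ-involutive)
open CommutativeSemigroup (CommutativeMonoid.commutativeSemigroup +ᴹ-commutativeMonoid)
  using (interchange)

-- Deciding statements over the plane by enumeration

Point : Set
Point = Carrierᴹ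

infix 4 _≟ᴹ_

_≟ᴹ_ : DecidableEquality Point
_≟ᴹ_ = ≡-dec _≟_ _≟_

open import Data.List.Membership.DecPropositional _≟ᴹ_ using (_∈?_)

allPoints? : ∀ {p} {Q : Pred Point p} → Decidable Q → Dec (∀ v → Q v)
allPoints? Q? = map′ (λ q (x , y) → q x y) (λ q x y → q (x , y))
  (all? λ x → all? λ y → Q? (x , y))

anyPoint? : ∀ {p} {Q : Pred Point p} → Decidable Q → Dec (∃ Q)
anyPoint? Q? = map′ (λ (x , y , q) → (x , y) , q) (λ ((x , y) , q) → x , y , q)
  (any? λ x → any? λ y → Q? (x , y))

-- Matrices and their linear maps

-- A matrix is the pair of its columns.
Matrix : Set
Matrix = Point × Point

-- Opaque, since conversion checking otherwise unfolds the modular arithmetic of open terms.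
opaque
  infixr 8 _⊙_

  _⊙_ : Matrix → Point → Point
  (u , v) ⊙ (x , y) = x *ₗ u +ᴹ y *ₗ v

e₁ e₂ : Point
e₁ = 1F , 0F
e₂ = 0F , 1F

opaque
  unfolding _⊙_

  ⊙-+ᴹ-homo : ∀ M v w → M ⊙ (v +ᴹ w) ≡ M ⊙ v +ᴹ M ⊙ w
  ⊙-+ᴹ-homo (a , b) (x , y) (x′ , y′) = ≡×≡⇒≡ (≈ᴹ-trans
    (+ᴹ-cong (*ₗ-distribʳ a x x′) (*ₗ-distribʳ b y y′))
    (interchange (x *ₗ a) (x′ *ₗ a) (y *ₗ b) (y′ *ₗ b)))

  ⊙-*ₗ-homo : ∀ M r v → M ⊙ (r *ₗ v) ≡ r *ₗ (M ⊙ v)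
  ⊙-*ₗ-homo (a , b) r (x , y) = ≡×≡⇒≡ (≈ᴹ-trans
    (+ᴹ-cong (*ₗ-assoc r x a) (*ₗ-assoc r y b))
    (≈ᴹ-sym (*ₗ-distribˡ r (x *ₗ a) (y *ₗ b))))

  ⊙-0ᴹ-homo : ∀ M → M ⊙ 0ᴹ ≡ 0ᴹ
  ⊙-0ᴹ-homo (a , b) = ≡×≡⇒≡ (≈ᴹ-trans (+ᴹ-cong (*ₗ-zeroˡ a) (*ₗ-zeroˡ b)) (+ᴹ-identityˡ 0ᴹ))

-- By additivity `M ⊙ (-ᴹ v)` and `M ⊙ v` sum to zero, and additive inverses are unique.
⊙-‿homo : ∀ M v → M ⊙ (-ᴹ v) ≡ -ᴹ (M ⊙ v)
⊙-‿homo M v = ≡×≡⇒≡ (uniqueʳ‿-ᴹ (M ⊙ v) (M ⊙ (-ᴹ v)) (≡⇒≡×≡ (begin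
  M ⊙ v +ᴹ M ⊙ (-ᴹ v)  ≡⟨ ⊙-+ᴹ-homo M v (-ᴹ v) ⟨
  M ⊙ (v +ᴹ (-ᴹ v))    ≡⟨ cong (M ⊙_) (≡×≡⇒≡ (-ᴹ‿inverseʳ v)) ⟩
  M ⊙ 0ᴹ               ≡⟨ ⊙-0ᴹ-homo M ⟩
  0ᴹ                   ∎)))
  where open ≡-Reasoning

⊙-isModuleHomomorphism : ∀ M → IsModuleHomomorphism (M ⊙_)
⊙-isModuleHomomorphism M = record
  { isBimoduleHomomorphism = record
    { +ᴹ-isGroupHomomorphism = record
      { isMonoidHomomorphism = record
        { isMagmaHomomorphism = record
          { isRelHomomorphism = record { cong = λ v≈w → ≡⇒≡×≡ (cong (M ⊙_) (≡×≡⇒≡ v≈w)) }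
          ; homo              = λ v w → ≡⇒≡×≡ (⊙-+ᴹ-homo M v w)
          }
        ; ε-homo = ≡⇒≡×≡ (⊙-0ᴹ-homo M)
        }
      ; ⁻¹-homo = λ v → ≡⇒≡×≡ (⊙-‿homo M v)
      }
    ; *ₗ-homo = λ r v → ≡⇒≡×≡ (⊙-*ₗ-homo M r v)
    ; *ᵣ-homo = λ r v → ≡⇒≡×≡ (begin
        M ⊙ (v *ᵣ r)    ≡⟨ cong (M ⊙_) (≡×≡⇒≡ (*ₗ-*ᵣ-coincident r v)) ⟨
        M ⊙ (r *ₗ v)    ≡⟨ ⊙-*ₗ-homo M r v ⟩
        r *ₗ (M ⊙ v)    ≡⟨ ≡×≡⇒≡ (*ₗ-*ᵣ-coincident r (M ⊙ v)) ⟩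
        (M ⊙ v) *ᵣ r    ∎)
    }
  }
  where open ≡-Reasoning

infix 9 _⁻¹

-- Cramer's rule, with the reciprocal of the determinant written as its cube; M ⁻¹ is zero for singular M.
_⁻¹ : Matrix → Matrix
((a , c) , (b , d)) ⁻¹ = δ *ₗ (d , -₅ c) , δ *ₗ (-₅ b , a)
  where
  det = a *₅ d +₅ -₅ (b *₅ c)
  δ   = det *₅ det *₅ det

-- Tested on the two columns only, which keeps it cheap to decide; linearity extends it to all
-- points in `leftInverse⇒cancel`.
LeftInverse : Matrix → Matrix → Set
LeftInverse N (u , v) = N ⊙ u ≡ e₁ × N ⊙ v ≡ e₂

Invertible : Pred Matrix 0ℓ
Invertible M = LeftInverse (M ⁻¹) M × LeftInverse M (M ⁻¹)

invertible? : Decidable Invertible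
invertible? M = leftInverse? (M ⁻¹) M ×-dec leftInverse? M (M ⁻¹)
  where
  leftInverse? : ∀ N M → Dec (LeftInverse N M)
  leftInverse? N (u , v) = N ⊙ u ≟ᴹ e₁ ×-dec N ⊙ v ≟ᴹ e₂

opaque
  unfolding _⊙_

  ⊙-identity : ∀ w → (e₁ , e₂) ⊙ w ≡ w
  ⊙-identity = toWitness {a? = allPoints? λ w → (e₁ , e₂) ⊙ w ≟ᴹ w} _

  ⊙-columns : ∀ u v → (u , v) ⊙ e₁ ≡ u × (u , v) ⊙ e₂ ≡ v
  ⊙-columns = toWitness
    {a? = allPoints? λ u → allPoints? λ v →
      (u , v) ⊙ e₁ ≟ᴹ u ×-dec (u , v) ⊙ e₂ ≟ᴹ v} _

  combination : ∀ u v ((x , y) : Point) → (u , v) ⊙ (x , y) ≡ x *ₗ u +ᴹ y *ₗ v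
  combination u v w = refl

leftInverse⇒cancel : ∀ {N} M → LeftInverse N M → ∀ w → N ⊙ M ⊙ w ≡ w
leftInverse⇒cancel {N} (u , v) (Nu≡e₁ , Nv≡e₂) w@(x , y) = begin
  N ⊙ (u , v) ⊙ w               ≡⟨ cong (N ⊙_) (combination u v w) ⟩
  N ⊙ (x *ₗ u +ᴹ y *ₗ v)        ≡⟨ ⊙-+ᴹ-homo N (x *ₗ u) (y *ₗ v) ⟩
  N ⊙ (x *ₗ u) +ᴹ N ⊙ (y *ₗ v)  ≡⟨ cong₂ _+ᴹ_ (⊙-*ₗ-homo N x u) (⊙-*ₗ-homo N y v) ⟩
  x *ₗ (N ⊙ u) +ᴹ y *ₗ (N ⊙ v)  ≡⟨ cong₂ (λ a b → x *ₗ a +ᴹ y *ₗ b) Nu≡e₁ Nv≡e₂ ⟩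
  x *ₗ e₁ +ᴹ y *ₗ e₂            ≡⟨ combination e₁ e₂ w ⟨
  (e₁ , e₂) ⊙ w                 ≡⟨ ⊙-identity w ⟩
  w                             ∎
  where open ≡-Reasoning

Inverses : Matrix → Matrix → Set
Inverses M N = (∀ w → N ⊙ M ⊙ w ≡ w) × (∀ w → M ⊙ N ⊙ w ≡ w)

invertible⇒inverses : ∀ M → Invertible M → Inverses M (M ⁻¹)
invertible⇒inverses M (left , right) =
  leftInverse⇒cancel M left , leftInverse⇒cancel (M ⁻¹) right

⊙-isModuleIsomorphism : ∀ M N → Inverses M N → IsModuleIsomorphism (M ⊙_)
⊙-isModuleIsomorphism M N (NM , MN) = record
  { isModuleMonomorphism = record
    { isModuleHomomorphism = ⊙-isModuleHomomorphism M
    ; injective = λ {v} {w} Mv≈Mw → ≡⇒≡×≡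
        (trans (sym (NM v)) (trans (cong (N ⊙_) (≡×≡⇒≡ Mv≈Mw)) (NM w)))
    }
  ; surjective = λ w → N ⊙ w , λ v≈Nw → ≡⇒≡×≡ (trans (cong (M ⊙_) (≡×≡⇒≡ v≈Nw)) (MN w))
  }

-- Zero is left out so that the list has four entries, just below the bound in `Large`; sum-freeness
-- excludes zero separately.
nonzeroMultiples : Point → List Point
nonzeroMultiples u = 1F *ₗ u ∷ 2F *ₗ u ∷ 3F *ₗ u ∷ 4F *ₗ u ∷ []

opaque
  unfolding _⊙_

  -- Under these conditions `v` lies off the line spanned by `u`, so the determinant is nonzero; all
  -- 625 pairs are evaluated.
  independent⇒invertible : ∀ u v → u ≢ 0ᴹ → v ≢ 0ᴹ → v ∉ₗ nonzeroMultiples u → Invertible (u , v)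
  independent⇒invertible = toWitness
    {a? = allPoints? λ u → allPoints? λ v →
      ¬? (u ≟ᴹ 0ᴹ) →-dec (¬? (v ≟ᴹ 0ᴹ) →-dec (¬? (v ∈? nonzeroMultiples u) →-dec invertible? (u , v)))} _

-- Having at least five elements, phrased through covering lists: this form transports along
-- matrices and refutes short lists directly.
Large : Pred (Pred Point 0ℓ) 0ℓ
Large P = ∀ L → length L < 5 → ¬ (P ⊆ fromList L)

-- Normality through linear functionals

infix 7 _∙_

_∙_ : Point → Point → Fin 5
(a , b) ∙ (x , y) = a *₅ x +₅ b *₅ y

AlignedWith : Point → Pred Point 0ℓ
AlignedWith f v = f ∙ v ≡ 1F ⊎ f ∙ v ≡ -₅ 1F

-- A decidable certificate that `f ∙ v = ±1` puts `v` in `H ∪ (-H)` for a line `H` missing the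
-- origin. Points at level -1 enter through their negatives, to match `Image -ᴹ_`.
IsLevelLine : (f base direction : Point) → Set
IsLevelLine f p d =
  d ≢ 0ᴹ ×
  (∀ t → 0ᴹ ≢ p +ᴹ t *ₗ d) ×
  (∀ v → f ∙ v ≡ 1F → ∃ λ t → v ≡ p +ᴹ t *ₗ d) ×
  (∀ v → f ∙ v ≡ -₅ 1F → ∃ λ t → -ᴹ v ≡ p +ᴹ t *ₗ d)

isLevelLine? : ∀ f p d → Dec (IsLevelLine f p d)
isLevelLine? f p d =
  ¬? (d ≟ᴹ 0ᴹ) ×-dec
  (all? λ t → ¬? (0ᴹ ≟ᴹ p +ᴹ t *ₗ d)) ×-dec
  (allPoints? λ v → f ∙ v ≟ 1F →-dec any? λ t → v ≟ᴹ p +ᴹ t *ₗ d) ×-dec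
  (allPoints? λ v → f ∙ v ≟ -₅ 1F →-dec any? λ t → -ᴹ v ≟ᴹ p +ᴹ t *ₗ d)

-- A point on a x + b y = 1: (1 / a , 0) or, when a = 0, (0 , 1 / b), with reciprocals written as cubes.
levelBase levelDirection : Point → Point
levelBase (a , b)      = a *₅ a *₅ a , (1F +₅ -₅ (a *₅ a *₅ a *₅ a)) *₅ (b *₅ b *₅ b)
levelDirection (a , b) = -₅ b , a

-- `levelDirection f` spans the kernel of `f`, and `f` takes the value 1 at `levelBase f` because
-- nonzero fourth powers are 1.
isLevelLine : ∀ f → f ≢ 0ᴹ → IsLevelLine f (levelBase f) (levelDirection f)
isLevelLine = toWitness {a? = allPoints? λ f →
  ¬? (f ≟ᴹ 0ᴹ) →-dec isLevelLine? f (levelBase f) (levelDirection f)} _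

levelLine⇒normal : ∀ {P : Pred Point 0ℓ} {f p d} → IsLevelLine f p d → P ⊆ AlignedWith f → Normal P
levelLine⇒normal {P} {f} {p} {d} (d≢0 , 0≢ , f≡1⇒∈ , f≡-1⇒∈) P⊆ = H , 0∉H , P⊆±H
  where
  H : AffineLine
  H = record { base = p ; direction = d ; direction≉0 = d≢0 ∘ ≡×≡⇒≡ }

  0∉H : 0ᴹ ∉ points H
  0∉H (t , 0≈) = 0≢ t (≡×≡⇒≡ 0≈)

  P⊆±H : P ⊆ points H ∪ Image -ᴹ_ (points H)
  P⊆±H {v} v∈P with P⊆ v∈P
  ... | inj₁ fv≡1  = let t , v≡ = f≡1⇒∈ v fv≡1 in inj₁ (t , ≡⇒≡×≡ v≡)
  ... | inj₂ fv≡-1 = let t , -v≡ = f≡-1⇒∈ v fv≡-1 in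
    inj₂ (-ᴹ v , (t , ≡⇒≡×≡ -v≡) , -ᴹ-involutive v)

aligned⇒normal : ∀ {P : Pred Point 0ℓ} {f} → f ≢ 0ᴹ → P ⊆ AlignedWith f → Normal P
aligned⇒normal {P} {f} f≢0 =
  levelLine⇒normal {P} {f} {levelBase f} {levelDirection f} (isLevelLine f f≢0)

-- An invertible matrix maps affine lines to affine lines, keeps them off the origin by injectivity,
-- and commutes with negation.
normal-image : ∀ M N → Inverses M N → {A P : Pred Point 0ℓ} →
  (∀ {v} → v ∈ A → ∃ λ w → w ∈ P × M ⊙ w ≡ v) → Normal P → Normal A
normal-image M N (NM , _) {A} A⊆MP (H , 0∉H , P⊆±H) = MH , 0∉MH , A⊆±MH
  where
  open AffineLine H using () renaming (base to p; direction to d; direction≉0 to d≉0)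

  reflects-0 : ∀ {w} → M ⊙ w ≡ 0ᴹ → w ≡ 0ᴹ
  reflects-0 {w} Mw≡0 = trans (sym (NM w)) (trans (cong (N ⊙_) Mw≡0) (⊙-0ᴹ-homo N))

  M-line : ∀ t → M ⊙ (p +ᴹ t *ₗ d) ≡ M ⊙ p +ᴹ t *ₗ (M ⊙ d)
  M-line t = trans (⊙-+ᴹ-homo M p (t *ₗ d)) (cong (M ⊙ p +ᴹ_) (⊙-*ₗ-homo M t d))

  MH : AffineLine
  MH = record { base = M ⊙ p ; direction = M ⊙ d ; direction≉0 = d≉0 ∘ ≡⇒≡×≡ ∘ reflects-0 ∘ ≡×≡⇒≡ }

  0∉MH : 0ᴹ ∉ points MH
  0∉MH (t , 0≈) = 0∉H (t , ≡⇒≡×≡ (sym (reflects-0 (trans (M-line t) (sym (≡×≡⇒≡ 0≈))))))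

  M-points : ∀ {w} → w ∈ points H → M ⊙ w ∈ points MH
  M-points (t , w≈) = t , ≡⇒≡×≡ (trans (cong (M ⊙_) (≡×≡⇒≡ w≈)) (M-line t))

  ±H⇒±MH : ∀ {w} → w ∈ points H ∪ Image -ᴹ_ (points H) →
    M ⊙ w ∈ points MH ∪ Image -ᴹ_ (points MH)
  ±H⇒±MH (inj₁ w∈H) = inj₁ (M-points w∈H)
  ±H⇒±MH (inj₂ (w , w∈H , -w≈v)) = inj₂ (M ⊙ w , M-points w∈H ,
    ≡⇒≡×≡ (trans (sym (⊙-‿homo M w)) (cong (M ⊙_) (≡×≡⇒≡ -w≈v))))

  A⊆±MH : A ⊆ points MH ∪ Image -ᴹ_ (points MH)
  A⊆±MH v∈A = let w , w∈P , Mw≡v = A⊆MP v∈A in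
    subst (_∈ points MH ∪ Image -ᴹ_ (points MH)) Mw≡v (±H⇒±MH (P⊆±H w∈P))

-- The search and its certificate

Compatible : List Point → Pred Point 0ℓ
Compatible cs p = p ∉ₗ cs × All (λ x → All (λ y → x +ᴹ y ∉ₗ p ∷ cs) (p ∷ cs)) (p ∷ cs)

compatible? : ∀ cs → Decidable (Compatible cs)
compatible? cs p = ¬? (p ∈? cs) ×-dec
  All.all? (λ x → All.all? (λ y → ¬? (x +ᴹ y ∈? p ∷ cs)) (p ∷ cs)) (p ∷ cs)

-- Points already chosen are filtered out as well, so the length test in `Dismissed` counts distinct
-- points.
candidates : (cs ps : List Point) → List Point
candidates cs = filter (compatible? cs)

-- Both alternatives pass to subsets, so testing all chosen and undecided points rules out every set
-- in the branch.
Dismissed : Pred (List Point) 0ℓ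
Dismissed L = length L < 5 ⊎ ∃ λ f → f ≢ 0ᴹ × All (AlignedWith f) L

dismissed? : Decidable Dismissed
dismissed? L = length L <? 5 ⊎-dec anyPoint? λ f →
  ¬? (f ≟ᴹ 0ᴹ) ×-dec All.all? (λ v → f ∙ v ≟ 1F ⊎-dec f ∙ v ≟ -₅ 1F) L

-- Containment in both directions, through the matrix and its inverse, gives equality of the two
-- point sets.
Models : (es cs : List Point) → Set
Models es cs = ∃ λ u → ∃ λ v → All (λ c → (u , v) ⊙ c ∈ₗ es) cs × Invertible (u , v) ×
  All (λ e → (u , v) ⁻¹ ⊙ e ∈ₗ cs) es

models? : ∀ es cs → Dec (Models es cs)
models? es cs = anyPoint? λ u → anyPoint? λ v →
  All.all? (λ c → (u , v) ⊙ c ∈? es) cs ×-dec invertible? (u , v) ×-dec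
  All.all? (λ e → (u , v) ⁻¹ ⊙ e ∈? cs) es

-- The decision procedure needs the points as data; `fromList` of these lists is `exceptional₁` and
-- `exceptional₂` by definition.
exceptionalList₁ exceptionalList₂ : List Point
exceptionalList₁ =
  (-₅ 2F , 1F) ∷ (-₅ 1F , 1F) ∷ (0F , 1F) ∷ (1F , 1F) ∷ (1F , -₅ 2F) ∷ []
exceptionalList₂ =
  (-₅ 1F , 1F) ∷ (0F , 1F) ∷ (1F , 1F) ∷ (1F , -₅ 2F) ∷ (-₅ 1F , -₅ 1F) ∷ []

Exceptional : Pred (List Point) 0ℓ
Exceptional cs = Models exceptionalList₁ cs ⊎ Models exceptionalList₂ cs

-- cs are the points already chosen and ps those still undecided; the first argument bounds the
-- depth of the search.
mutual

  Settled : ℕ → (cs ps : List Point) → Set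
  Settled zero    cs ps = ⊥
  Settled (suc n) cs ps = Dismissed (cs ++ ps) ⊎ Split n cs ps

  Split : ℕ → (cs ps : List Point) → Set
  Split n cs []       = Exceptional cs
  Split n cs (p ∷ ps) = Settled n (p ∷ cs) (candidates (p ∷ cs) ps) × Settled n cs ps

mutual

  settled? : ∀ n cs ps → Dec (Settled n cs ps)
  settled? zero    cs ps = no id
  settled? (suc n) cs ps = dismissed? (cs ++ ps) ⊎-dec split? n cs ps

  split? : ∀ n cs ps → Dec (Split n cs ps)
  split? n cs []       = models? exceptionalList₁ cs ⊎-dec models? exceptionalList₂ cs
  split? n cs (p ∷ ps) =
    settled? n (p ∷ cs) (candidates (p ∷ cs) ps) ×-dec settled? n cs ps

standardBasis : List Point
standardBasis = e₁ ∷ e₂ ∷ []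

allPoints : List Point
allPoints = cartesianProduct (allFin 5) (allFin 5)

opaque
  unfolding _⊙_

  -- Fifteen candidates remain and each level decides at least one; the sixteenth level treats the
  -- empty list.
  settled : Settled 16 standardBasis (candidates standardBasis allPoints)
  settled = toWitness {a? = settled? 16 standardBasis (candidates standardBasis allPoints)} _

-- Cardinality and covering lists

∣p∪q∣≤∣p∣+∣q∣ : ∀ {n} (p q : Subset n) → ∣ p ∪ₛ q ∣ ≤ ∣ p ∣ ℕ.+ ∣ q ∣
∣p∪q∣≤∣p∣+∣q∣ []          []          = z≤n
∣p∪q∣≤∣p∣+∣q∣ (false ∷ p) (false ∷ q) = ∣p∪q∣≤∣p∣+∣q∣ p q
∣p∪q∣≤∣p∣+∣q∣ (false ∷ p) (true  ∷ q) =
  ≤-trans (s≤s (∣p∪q∣≤∣p∣+∣q∣ p q)) (≤-reflexive (sym (+-suc ∣ p ∣ ∣ q ∣)))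
∣p∪q∣≤∣p∣+∣q∣ (true  ∷ p) (false ∷ q) = s≤s (∣p∪q∣≤∣p∣+∣q∣ p q)
∣p∪q∣≤∣p∣+∣q∣ (true  ∷ p) (true  ∷ q) =
  s≤s (≤-trans (∣p∪q∣≤∣p∣+∣q∣ p q) (+-monoʳ-≤ ∣ p ∣ (n≤1+n ∣ q ∣)))

index : Point → Fin 25
index (x , y) = combine x y

listed : List Point → PlaneSubset
listed = ⋃ ∘ map (⁅_⁆ ∘ index)

∣listed∣≤length : ∀ L → ∣ listed L ∣ ≤ length L
∣listed∣≤length []      = ≤-reflexive (∣⊥∣≡0 25)
∣listed∣≤length (v ∷ L) = begin
  ∣ ⁅ index v ⁆ ∪ₛ listed L ∣       ≤⟨ ∣p∪q∣≤∣p∣+∣q∣ ⁅ index v ⁆ (listed L) ⟩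
  ∣ ⁅ index v ⁆ ∣ ℕ.+ ∣ listed L ∣  ≡⟨ cong (ℕ._+ ∣ listed L ∣) (∣⁅x⁆∣≡1 (index v)) ⟩
  suc ∣ listed L ∣                    ≤⟨ s≤s (∣listed∣≤length L) ⟩
  suc (length L)                      ∎
  where open ≤-Reasoning

∈-listed : ∀ v L → v ∈ₗ L → index v ∈ₛ listed L
∈-listed v (_ ∷ L) (here refl) = x∈p∪q⁺ (inj₁ (x∈⁅x⁆ (index v)))
∈-listed v (_ ∷ L) (there v∈L) = x∈p∪q⁺ (inj₂ (∈-listed v L v∈L))

-- Converts the cardinality hypothesis into `Large`.
⊆⇒∣∣≤length : ∀ A L → ⟦ A ⟧ ⊆ fromList L → ∣ A ∣ ≤ length L
⊆⇒∣∣≤length A L A⊆L = ≤-trans (p⊆q⇒∣p∣≤∣q∣ A⊆listed) (∣listed∣≤length L)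
  where
  A⊆listed : A ⊆ₛ listed L
  A⊆listed {i} i∈A = subst (_∈ₛ listed L) (combine-remQuot 5 i)
    (∈-listed (remQuot 5 i) L (A⊆L (subst (_∈ₛ A) (sym (combine-remQuot 5 i)) i∈A)))

-- The plane is finite and both memberships are decidable, so a failed inclusion yields an explicit
-- point.
outside : ∀ {P} → Decidable P → Large P → ∀ L → length L < 5 → ∃ λ v → v ∈ P × v ∉ₗ L
outside P? large L ∣L∣<5 with anyPoint? (λ v → P? v ×-dec ¬? (v ∈? L))
... | yes found = found
... | no ¬found = contradiction
  (λ {v} v∈P → decidable-stable (v ∈? L) λ v∉L → ¬found (v , v∈P , v∉L)) (large L ∣L∣<5)

-- Soundness of the search

module _ {P : Pred Point 0ℓ} (P? : Decidable P) (sumFree : SumFreeInPlane P)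
         (large : Large P) (¬normal : ¬ Normal P) where

  ¬dismissed : ∀ {L} → P ⊆ fromList L → ¬ Dismissed L
  ¬dismissed P⊆L (inj₁ ∣L∣<5)               = large _ ∣L∣<5 P⊆L
  ¬dismissed P⊆L (inj₂ (f , f≢0 , aligned)) = ¬normal (aligned⇒normal f≢0 (All.lookup aligned ∘ P⊆L))

  compatible : ∀ {cs p} → All P cs → p ∈ P → p ∉ₗ cs → Compatible cs p
  compatible P-cs p∈P p∉cs = p∉cs ,
    All.map (λ x∈P → All.map (λ y∈P x+y∈ → sumFree x∈P y∈P (All.lookup P-p∷cs x+y∈) ≈ᴹ-refl)
      P-p∷cs) P-p∷cs
    where P-p∷cs = p∈P ∷ P-cs

  -- A discarded point is already in `cs` or would create a forbidden sum with chosen points, so no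
  -- point of `P` is lost.
  ⊆-candidates : ∀ {cs} ps → All P cs → P ⊆ fromList (cs ++ ps) →
    P ⊆ fromList (cs ++ candidates cs ps)
  ⊆-candidates {cs} ps P-cs P⊆ {w} w∈P with w ∈? cs
  ... | yes w∈cs = ∈-++⁺ˡ w∈cs
  ... | no  w∉cs with ∈-++⁻ cs (P⊆ w∈P)
  ...   | inj₁ w∈cs = contradiction w∈cs w∉cs
  ...   | inj₂ w∈ps = ∈-++⁺ʳ cs (∈-filter⁺ (compatible? cs) w∈ps (compatible P-cs w∈P w∉cs))

  Found : Set
  Found = ∃ λ cs → Exceptional cs × All P cs × P ⊆ fromList cs

  ⊆-drop : ∀ {p L} → p ∉ P → P ⊆ fromList (p ∷ L) → P ⊆ fromList L
  ⊆-drop {p} p∉P P⊆ {w} w∈P = Any.tail (λ w≡p → p∉P (subst P w≡p w∈P)) (P⊆ w∈P)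

  -- Membership in `P` selects the branch of the certificate. The invariant is that `P` contains the
  -- chosen points and is covered by the chosen and undecided ones.
  search : ∀ n cs ps → Settled n cs ps → All P cs → P ⊆ fromList (cs ++ ps) → Found
  search (suc n) cs ps       (inj₁ dismissed) P-cs P⊆ = contradiction dismissed (¬dismissed P⊆)
  search (suc n) cs []       (inj₂ exc)       P-cs P⊆ =
    cs , exc , P-cs , λ {w} w∈P → subst (w ∈ₗ_) (++-identityʳ cs) (P⊆ w∈P)
  search (suc n) cs (p ∷ ps) (inj₂ (with-p , without-p)) P-cs P⊆ = case P? p of λ
    { (yes p∈P) → search n (p ∷ cs) (candidates (p ∷ cs) ps) with-p (p∈P ∷ P-cs)
        (⊆-candidates ps (p∈P ∷ P-cs) P⊆p∷cs++ps)
    ; (no p∉P)  → search n cs ps without-p P-cs (⊆-drop p∉P P⊆p∷cs++ps)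
    }
    where
    P⊆p∷cs++ps : P ⊆ fromList (p ∷ cs ++ ps)
    P⊆p∷cs++ps w∈P = ∈-resp-↭ (shift p cs ps) (P⊆ w∈P)

  found : e₁ ∈ P → e₂ ∈ P → Found
  found e₁∈P e₂∈P = search 16 standardBasis (candidates standardBasis allPoints) settled P-basis
    (⊆-candidates allPoints P-basis
      (λ _ → ∈-++⁺ʳ standardBasis (∈-cartesianProduct⁺ (∈-allFin _) (∈-allFin _))))
    where
    P-basis : All P standardBasis
    P-basis = e₁∈P ∷ e₂∈P ∷ []

-- Transport back to the original set

isomorphic-list : ∀ M M′ N N′ → Inverses M M′ → Inverses N N′ →
  {A : Pred Point 0ℓ} {es cs : List Point} →
  All (λ c → N ⊙ c ∈ₗ es) cs → All (λ e → N′ ⊙ e ∈ₗ cs) es →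
  All (λ c → M ⊙ c ∈ A) cs → (∀ {w} → M ⊙ w ∈ A → w ∈ₗ cs) → Isomorphic A (fromList es)
isomorphic-list M M′ N N′ (M′M , MM′) (N′N , NN′) {A} {es} {cs} cs→es es→cs cs→A A→cs =
  -- `M′` takes `A` to its coordinate set `cs`, which `N` carries onto `es`.
  (λ a → N ⊙ M′ ⊙ a) ,
  Composition.isModuleIsomorphism ≈ᴹ-trans
    (⊙-isModuleIsomorphism M′ M (MM′ , M′M)) (⊙-isModuleIsomorphism N N′ (N′N , NN′)) ,
  A⊆es , es⊆A
  where
  A⊆es : Image (λ a → N ⊙ M′ ⊙ a) A ⊆ fromList es
  A⊆es (a , a∈A , NM′a≈w) = subst (_∈ₗ es) (≡×≡⇒≡ NM′a≈w)
    (All.lookup cs→es (A→cs (subst A (sym (MM′ a)) a∈A)))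

  es⊆A : fromList es ⊆ Image (λ a → N ⊙ M′ ⊙ a) A
  es⊆A {w} w∈es = M ⊙ N′ ⊙ w , All.lookup cs→A (All.lookup es→cs w∈es) ,
    ≡⇒≡×≡ (trans (cong (N ⊙_) (M′M (N′ ⊙ w))) (NN′ w))

models⇒isomorphic : ∀ M M′ → Inverses M M′ → {A : Pred Point 0ℓ} {es cs : List Point} →
  Models es cs → All (λ c → M ⊙ c ∈ A) cs → (∀ {w} → M ⊙ w ∈ A → w ∈ₗ cs) →
  Isomorphic A (fromList es)
models⇒isomorphic M M′ M-inv (u , v , cs→es , N-inv , es→cs) =
  isomorphic-list M M′ (u , v) ((u , v) ⁻¹) M-inv (invertible⇒inverses (u , v) N-inv) cs→es es→cs

module _ {A : Pred Point 0ℓ} (A? : Decidable A) (sumFree : SumFreeInPlane A)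
         (large : Large A) (¬normal : ¬ Normal A) where

  -- The search runs on the preimage of `A` under `M`, which contains `e₁` and `e₂` and inherits
  -- sum-freeness, size and non-normality.
  isomorphic-in-basis : ∀ M N → Inverses M N → M ⊙ e₁ ∈ A → M ⊙ e₂ ∈ A →
    Isomorphic A exceptional₁ ⊎ Isomorphic A exceptional₂
  isomorphic-in-basis M N M-inv@(_ , MN) Me₁∈A Me₂∈A =
    let cs , exceptional , cs⊆P , P⊆cs =
          found (A? ∘ (M ⊙_)) P-sumFree P-large (¬normal ∘ normal-image M N M-inv A⊆MP) Me₁∈A Me₂∈A
    in Sum.map (λ models → models⇒isomorphic M N M-inv models cs⊆P P⊆cs)
               (λ models → models⇒isomorphic M N M-inv models cs⊆P P⊆cs) exceptional
    where
    P : Pred Point 0ℓ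
    P w = M ⊙ w ∈ A

    A⊆MP : ∀ {v} → v ∈ A → ∃ λ w → w ∈ P × M ⊙ w ≡ v
    A⊆MP {v} v∈A = N ⊙ v , subst A (sym (MN v)) v∈A , MN v

    P-sumFree : SumFreeInPlane P
    P-sumFree {x} {y} x∈P y∈P z∈P x+y≈z = sumFree x∈P y∈P z∈P
      (≡⇒≡×≡ (trans (sym (⊙-+ᴹ-homo M x y)) (cong (M ⊙_) (≡×≡⇒≡ x+y≈z))))

    P-large : Large P
    P-large L ∣L∣<5 P⊆L = large (map (M ⊙_) L) (subst (_< 5) (sym (length-map (M ⊙_) L)) ∣L∣<5)
      λ v∈A → let w , w∈P , Mw≡v = A⊆MP v∈A in
        subst (_∈ₗ map (M ⊙_) L) Mw≡v (∈-map⁺ (M ⊙_) (P⊆L w∈P))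

  A∌0 : ∀ {v} → v ∈ A → v ≢ 0ᴹ
  A∌0 v∈A refl = sumFree v∈A v∈A v∈A ≈ᴹ-refl

  large-sumFree⇒exceptional : Isomorphic A exceptional₁ ⊎ Isomorphic A exceptional₂
  large-sumFree⇒exceptional =
    let u , u∈A , _   = outside A? large [] (s≤s z≤n)
        v , v∈A , v∉u = outside A? large (nonzeroMultiples u) (n<1+n 4)
        M             = u , v
        invertible    = independent⇒invertible u v (A∌0 u∈A) (A∌0 v∈A) v∉u
        Me₁≡u , Me₂≡v = ⊙-columns u v
    in isomorphic-in-basis M (M ⁻¹) (invertible⇒inverses M invertible)
         (subst A (sym Me₁≡u) u∈A) (subst A (sym Me₂≡v) v∈A)

theorem1p1 : ∀ (A : PlaneSubset) → SumFreeInPlane ⟦ A ⟧ → ∣ A ∣ ≥ 5 → ¬ Normal ⟦ A ⟧ →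
    Isomorphic ⟦ A ⟧ exceptional₁ ⊎ Isomorphic ⟦ A ⟧ exceptional₂
theorem1p1 A sumFree ∣A∣≥5 = large-sumFree⇒exceptional
  (λ (x , y) → combine x y ∈ₛ? A)
  (λ {x} {y} {z} → sumFree {x} {y} {z})
  (λ L ∣L∣<5 A⊆L → <⇒≱ ∣L∣<5 (≤-trans ∣A∣≥5 (⊆⇒∣∣≤length A L A⊆L)))
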